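{- Let $p\ge1$, $m=2p$, and $V=\{2s\}$ for some integer $1\le s\le p$. Then the sequence $H(D^{(2p,\{2s\})})$ can be partitioned into consecutive sections of the form \[H(D^{(2p,\{2s\})})=(\underbrace{1,\dots,1}_{s},\underbrace{a_{1,1},\dots,a_{1,p}}_{p},\underbrace{a_{2,1},\dots,a_{2,p}}_{p},\underbrace{a_{3,1},\dots,a_{3,p}}_{p},\dots)\] such that each section $(a_{j,1},\dots,a_{j,p})$ is an arithmetic progression with common difference $d_j$, where $a_{1,1}=0$, $d_1=-1$, and for $j\ge2$: $a_{j,1}=d_{j-1}$ and $d_j=d_{j-1}-a_{j-1,p}$.
   Context: For an integer $m\ge 2$ and $V\subseteq[m]=\{1,\dots,m\}$, let $(m,V)=\{k\in\mathbb{Z}^+ : k\equiv j \pmod m \text{ for some } j\in V\}$. A Dyck path of size $n$ is a lattice path from $(0,0)$ to $(2n,0)$ with steps $(1,1)$ and $(1,-1)$ never going below the $x$-axis; a peak is an up-step immediately followed by a down-step, and its height is the $y$-coordinate of the point between them. Let $d_n^{(m,V)}$ be the number of Dyck paths of size $n$ none of whose peaks has height in $(m,V)$, and $D^{(m,V)}(x)=\sum_{n\ge0}d_n^{(m,V)}x^n$. For a power series $F=\sum f_nx^n$ and $n\ge1$, $H_n(F)=\det(f_{i+j})_{0\le i,j\le n-1}$ and $H(F)=(H_1(F),H_2(F),\dots)$. -}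

module Defs where

open import Data.Bool using (Bool; true; false; _∧_; not)
open import Data.Nat using (ℕ; zero; suc; _+_; _*_; _∸_; _%_; _≡ᵇ_)
open import Data.List using (List; []; _∷_; _++_; map; length; filterᵇ)
open import Data.Bool.ListAction using (any)
open import Data.Fin using (Fin; zero; suc; punchIn; toℕ)
open import Data.Integer using (ℤ; +_; -_) renaming (_+_ to _+ℤ_; _*_ to _*ℤ_)

-- Steps: true = up-step (1,1), false = down-step (1,-1).
Step : Set
Step = Bool

words : ℕ → List (List Step)
words zero = [] ∷ []
words (suc n) = map (true ∷_) (words n) ++ map (false ∷_) (words n)

dyckFrom : ℕ → List Step → Bool
dyckFrom zero [] = true
dyckFrom (suc _) [] = false
dyckFrom h (true ∷ w) = dyckFrom (suc h) w
dyckFrom zero (false ∷ w) = false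
dyckFrom (suc h) (false ∷ w) = dyckFrom h w

isDyck : List Step → Bool
isDyck = dyckFrom 0

peakHeights : ℕ → List Step → List ℕ
peakHeights h [] = []
peakHeights h (true ∷ false ∷ w) = suc h ∷ peakHeights h w
peakHeights h (true ∷ w) = peakHeights (suc h) w
peakHeights h (false ∷ w) = peakHeights (h ∸ 1) w

-- k ∈ (m,V) : k positive and k ≡ j (mod m) for some j ∈ V  (m ≥ 2 in use)
inMV : (m : ℕ) → List ℕ → ℕ → Bool
inMV m V zero = false
inMV zero V (suc k) = false
inMV (suc m) V (suc k) = any (λ j → (suc k % suc m) ≡ᵇ (j % suc m)) V

dMV : (m : ℕ) → List ℕ → ℕ → ℕ
dMV m V n = length (filterᵇ (λ w → isDyck w ∧ not (any (inMV m V) (peakHeights 0 w)))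
                            (words (2 * n)))

sumFin : (n : ℕ) → (Fin n → ℤ) → ℤ
sumFin zero f = + 0
sumFin (suc n) f = f zero +ℤ sumFin n (λ i → f (suc i))

sign : ℕ → ℤ
sign zero = + 1
sign (suc k) = - sign k

det : (n : ℕ) → (Fin n → Fin n → ℤ) → ℤ
det zero M = + 1
det (suc n) M = sumFin (suc n) (λ j →
  sign (toℕ j) *ℤ (M zero j *ℤ det n (λ r c → M (suc r) (punchIn j c))))

hankel : (ℕ → ℤ) → ℕ → ℤ
hankel f n = det n (λ i j → f (toℕ i + toℕ j))

HD : (m : ℕ) → List ℕ → ℕ → ℤ
HD m V = hankel (λ k → + dMV m V k)

-- Taking steps in pairs, the number f n of Dyck paths becomes a moment ⟨u₀ , T uₙ⟩, where T is the Jacobi matrix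
-- with off-diagonal entries 1 and diagonal c₀ = 1, cₖ = 1 if height 2k is forbidden and cₖ = 2 otherwise, and
-- where uᵢ is supported on [0 , i] with last coordinate 1. As T is self-adjoint, f (i + j) = ⟨uᵢ , T uⱼ⟩, so the
-- Hankel matrix is U T Uᵗ with U lower unitriangular, and Hₙ is the leading n × n minor θₙ of T. The continuant
-- recurrence θₙ₊₁ = cₙ θₙ - θₙ₋₁ keeps the difference θₙ₊₁ - θₙ constant where cₙ = 2 and lowers it by θₙ where
-- cₙ = 1, which happens (for n ≥ 1) exactly at n = s + j p.
module Submission where

open import Defs
open import Data.Bool using (Bool; true; false; _∧_; not; T; T?)
open import Data.Bool.ListAction using (any)
open import Data.Bool.Properties using (∧-zeroʳ)
open import Data.Fin using (Fin; zero; suc; toℕ; inject₁; fromℕ<; punchIn; punchOut)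
open import Data.Fin.Properties
  using (punchInᵢ≢i; punchIn-injective; punchIn-punchOut; toℕ-inject₁; toℕ-injective; toℕ-fromℕ<; toℕ<n)
  renaming (_≟_ to _≟ᶠ_; <-cmp to <-cmpᶠ)
open import Data.Nat using (ℕ; zero; suc; _+_; _*_; _∸_; _≤_; _<_; z≤n; s≤s; NonZero; _≡ᵇ_; _<?_)
import Data.Nat.Properties as ℕ
open import Data.Nat.Divisibility using (_∣_; divides; ∣m+n∣m⇒∣n; ∣⇒≤; ∣n∣m%n⇒∣m; %-presˡ-∣)
open import Data.Nat.DivMod using (_%_; _/_; m≡m%n+[m/n]*n; [m+kn]%n≡m%n)
open import Data.Nat.Tactic.RingSolver using () renaming (solve-∀ to solve-∀ᴺ)
open import Data.Integer using (ℤ; +_; -_; _-_) renaming (_+_ to _+ℤ_; _*_ to _*ℤ_)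
import Data.Integer.Properties as ℤ
open import Data.Integer.Tactic.RingSolver using (solve-∀)
open import Data.List using (List; _∷_; []; _++_; map; length; filterᵇ)
open import Data.List.Properties using (length-++; filter-++)
open import Data.Product using (Σ; _×_; _,_)
open import Data.Vec.Functional using (updateAt)
open import Data.Vec.Functional.Properties using (updateAt-updates; updateAt-minimal)
open import Function using (_∘_; const)
open import Relation.Binary using (tri<; tri≈; tri>)
open import Relation.Binary.PropositionalEquality
  using (_≡_; _≢_; refl; sym; trans; cong; cong₂; subst; module ≡-Reasoning)
open import Relation.Nullary using (¬_; yes; no; contradiction)

-- Finite sums

sumFin-cong : ∀ {n} {f g : Fin n → ℤ} → (∀ i → f i ≡ g i) → sumFin n f ≡ sumFin n g
sumFin-cong {zero}  f≗g = refl
sumFin-cong {suc n} f≗g = cong₂ _+ℤ_ (f≗g zero) (sumFin-cong (f≗g ∘ suc))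

sumFin-zero : ∀ {n} {f : Fin n → ℤ} → (∀ i → f i ≡ + 0) → sumFin n f ≡ + 0
sumFin-zero {zero}  f≗0 = refl
sumFin-zero {suc n} f≗0 = cong₂ _+ℤ_ (f≗0 zero) (sumFin-zero (f≗0 ∘ suc))

sumFin-linear : ∀ {n} (f g : Fin n → ℤ) (α : ℤ) →
  sumFin n (λ i → f i +ℤ α *ℤ g i) ≡ sumFin n f +ℤ α *ℤ sumFin n g
sumFin-linear {zero}  f g α = sym (trans (ℤ.+-identityˡ _) (ℤ.*-zeroʳ α))
sumFin-linear {suc n} f g α =
  trans (cong (f zero +ℤ α *ℤ g zero +ℤ_) (sumFin-linear (f ∘ suc) (g ∘ suc) α))
        (interchange (f zero) (g zero) (sumFin n (f ∘ suc)) (sumFin n (g ∘ suc)) α)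
  where
  interchange : ∀ a b c d α → (a +ℤ α *ℤ b) +ℤ (c +ℤ α *ℤ d) ≡ (a +ℤ c) +ℤ α *ℤ (b +ℤ d)
  interchange = solve-∀

sumFin-neg : ∀ {n} (f : Fin n → ℤ) → sumFin n (λ i → - f i) ≡ - sumFin n f
sumFin-neg {zero}  f = refl
sumFin-neg {suc n} f =
  trans (cong (- f zero +ℤ_) (sumFin-neg (f ∘ suc))) (sym (ℤ.neg-distrib-+ (f zero) _))

sumFin-only : ∀ {n} (f : Fin n → ℤ) (b : Fin n) → (∀ k → k ≢ b → f k ≡ + 0) → sumFin n f ≡ f b
sumFin-only f zero    f≡0 =
  trans (cong (f zero +ℤ_) (sumFin-zero λ k → f≡0 (suc k) λ ())) (ℤ.+-identityʳ _)
sumFin-only f (suc b) f≡0 =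
  trans (cong₂ _+ℤ_ (f≡0 zero λ ()) (sumFin-only (f ∘ suc) b λ k k≢b → f≡0 (suc k) λ { refl → k≢b refl }))
        (ℤ.+-identityˡ _)

sumFin-last : ∀ n (f : ℕ → ℤ) → sumFin (suc n) (f ∘ toℕ) ≡ sumFin n (f ∘ toℕ) +ℤ f n
sumFin-last zero    f = ℤ.+-comm (f 0) (+ 0)
sumFin-last (suc n) f =
  trans (cong (f 0 +ℤ_) (sumFin-last n (f ∘ suc))) (sym (ℤ.+-assoc (f 0) _ _))

-- Determinants

Matrix : ℕ → Set
Matrix n = Fin n → Fin n → ℤ

minor : ∀ {n} → Matrix (suc n) → Fin (suc n) → Matrix n
minor M j i k = M (suc i) (punchIn j k)

laplaceTerm : ∀ {n} → Matrix (suc n) → Fin (suc n) → ℤ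
laplaceTerm {n} M j = sign (toℕ j) *ℤ (M zero j *ℤ det n (minor M j))

det-cong : ∀ {n} {M N : Matrix n} → (∀ i k → M i k ≡ N i k) → det n M ≡ det n N
det-cong {zero}  M≗N = refl
det-cong {suc n} M≗N = sumFin-cong λ j →
  cong (sign (toℕ j) *ℤ_) (cong₂ _*ℤ_ (M≗N zero j) (det-cong λ i k → M≗N (suc i) (punchIn j k)))

-- Induction along the Laplace expansion of row 0. In the term `j ≡ c` the entry carries the
-- combination and the minors agree; in any other term the entries agree and the combination sits in
-- column `punchOut j≢c` of the minor.
det-linear : ∀ {n} (c : Fin n) (L M N : Matrix n) (α : ℤ) →
  (∀ i k → k ≢ c → L i k ≡ M i k) → (∀ i k → k ≢ c → N i k ≡ M i k) →
  (∀ i → L i c ≡ M i c +ℤ α *ℤ N i c) →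
  det n L ≡ det n M +ℤ α *ℤ det n N
det-linear {suc n} c L M N α L≡M N≡M at-c =
  trans (sumFin-cong term) (sumFin-linear (laplaceTerm M) (laplaceTerm N) α)
  where
  inside : ∀ s x y m α → s *ℤ ((x +ℤ α *ℤ y) *ℤ m) ≡ s *ℤ (x *ℤ m) +ℤ α *ℤ (s *ℤ (y *ℤ m))
  inside = solve-∀
  outside : ∀ s x m m′ α → s *ℤ (x *ℤ (m +ℤ α *ℤ m′)) ≡ s *ℤ (x *ℤ m) +ℤ α *ℤ (s *ℤ (x *ℤ m′))
  outside = solve-∀
  away : ∀ {j} (j≢c : j ≢ c) k → k ≢ punchOut j≢c → punchIn j k ≢ c
  away j≢c k k≢ eq = k≢ (punchIn-injective _ _ _ (trans eq (sym (punchIn-punchOut j≢c))))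
  term : ∀ j → laplaceTerm L j ≡ laplaceTerm M j +ℤ α *ℤ laplaceTerm N j
  term j with j ≟ᶠ c
  ... | yes refl
    rewrite at-c zero
          | det-cong {M = minor L j} {minor M j} (λ i k → L≡M (suc i) (punchIn j k) (punchInᵢ≢i j k))
          | det-cong {M = minor N j} {minor M j} (λ i k → N≡M (suc i) (punchIn j k) (punchInᵢ≢i j k))
    = inside (sign (toℕ j)) (M zero j) (N zero j) (det n (minor M j)) α
  ... | no j≢c
    rewrite L≡M zero j j≢c | N≡M zero j j≢c
          | det-linear (punchOut j≢c) (minor L j) (minor M j) (minor N j) α
              (λ i k k≢ → L≡M (suc i) (punchIn j k) (away j≢c k k≢))
              (λ i k k≢ → N≡M (suc i) (punchIn j k) (away j≢c k k≢))
              (λ i → subst (λ l → L (suc i) l ≡ M (suc i) l +ℤ α *ℤ N (suc i) l)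
                           (sym (punchIn-punchOut j≢c)) (at-c (suc i)))
    = outside (sign (toℕ j)) (M zero j) (det n (minor M j)) (det n (minor N j)) α

-- The transposition of the adjacent indices `inject₁ c` and `suc c`. Adjacent ones suffice, and
-- each reverses the sign of the determinant.
swap : ∀ {n} → Fin n → Fin (suc n) → Fin (suc n)
swap zero    zero          = suc zero
swap zero    (suc zero)    = zero
swap zero    (suc (suc k)) = suc (suc k)
swap (suc c) zero          = zero
swap (suc c) (suc k)       = suc (swap c k)

swap-invariant : ∀ {n} (b : Fin n) (f : Fin (suc n) → ℤ) → f (inject₁ b) ≡ f (suc b) →
  ∀ k → f (swap b k) ≡ f k
swap-invariant zero    f eq zero          = sym eq
swap-invariant zero    f eq (suc zero)    = eq
swap-invariant zero    f eq (suc (suc k)) = refl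
swap-invariant (suc b) f eq zero          = refl
swap-invariant (suc b) f eq (suc k)       = swap-invariant b (f ∘ suc) eq k

swap-inject₁ : ∀ {n} (b : Fin n) → swap b (inject₁ b) ≡ suc b
swap-inject₁ zero    = refl
swap-inject₁ (suc b) = cong suc (swap-inject₁ b)

swap-below : ∀ {n} (b : Fin n) (a : Fin (suc n)) → toℕ a < toℕ b → swap b a ≡ a
swap-below (suc b) zero    a<b       = refl
swap-below (suc b) (suc a) (s≤s a<b) = cong suc (swap-below b a a<b)

sumFin-swap : ∀ {n} (c : Fin n) (f : Fin (suc n) → ℤ) → sumFin (suc n) (f ∘ swap c) ≡ sumFin (suc n) f
sumFin-swap zero    f = exchange (f (suc zero)) (f zero) _
  where
  exchange : ∀ x y z → x +ℤ (y +ℤ z) ≡ y +ℤ (x +ℤ z)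
  exchange = solve-∀
sumFin-swap (suc c) f = cong (f zero +ℤ_) (sumFin-swap c (f ∘ suc))

-- How a swap of columns meets deletion of column `j`. Either `j` stays put and the swap descends to
-- an adjacent swap of the minor, or `j` is one of the two exchanged columns: the minor is then
-- unchanged, but the sign in front of it flips.
data SwapPosition {n} (c : Fin (suc n)) (j : Fin (suc (suc n))) : Set where
  fixed : swap c j ≡ j → (c′ : Fin n) →
          (∀ k → swap c (punchIn j k) ≡ punchIn j (swap c′ k)) → SwapPosition c j
  moved : sign (toℕ j) ≡ - sign (toℕ (swap c j)) →
          (∀ k → swap c (punchIn j k) ≡ punchIn (swap c j) k) → SwapPosition c j

swap-position : ∀ {n} (c : Fin (suc n)) (j : Fin (suc (suc n))) → SwapPosition c j
swap-position zero zero       = moved refl λ { zero → refl ; (suc k) → refl }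
swap-position zero (suc zero) = moved refl λ { zero → refl ; (suc k) → refl }
swap-position {suc n} zero (suc (suc j)) =
  fixed refl zero λ { zero → refl ; (suc zero) → refl ; (suc (suc k)) → refl }
swap-position {suc n} (suc c) zero = fixed refl c λ k → refl
swap-position {suc n} (suc c) (suc j) with swap-position c j
... | fixed eq c′ comm = fixed (cong suc eq) (suc c′) λ { zero → refl ; (suc k) → cong suc (comm k) }
... | moved eq comm    = moved (cong -_ eq) λ { zero → refl ; (suc k) → cong suc (comm k) }

-- Each Laplace term becomes minus the term at the swapped index: for a fixed column the sign comes
-- from the smaller determinant by induction, for a moved one from the checkerboard sign. Reindexing
-- the sum by `swap c` finishes.
det-swap : ∀ {n} (c : Fin n) (M : Matrix (suc n)) →
  det (suc n) (λ i k → M i (swap c k)) ≡ - det (suc n) M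
det-swap {suc n} c M = begin
  det (suc (suc n)) N
    ≡⟨ sumFin-cong term ⟩
  sumFin (suc (suc n)) (λ j → - laplaceTerm M (swap c j))
    ≡⟨ sumFin-swap c (λ j → - laplaceTerm M j) ⟩
  sumFin (suc (suc n)) (λ j → - laplaceTerm M j)
    ≡⟨ sumFin-neg (laplaceTerm M) ⟩
  - det (suc (suc n)) M ∎
  where
  open ≡-Reasoning
  N : Matrix (suc (suc n))
  N i k = M i (swap c k)
  neg-last : ∀ s x m → s *ℤ (x *ℤ (- m)) ≡ - (s *ℤ (x *ℤ m))
  neg-last = solve-∀
  neg-first : ∀ s x m → (- s) *ℤ (x *ℤ m) ≡ - (s *ℤ (x *ℤ m))
  neg-first = solve-∀
  term : ∀ j → laplaceTerm N j ≡ - laplaceTerm M (swap c j)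
  term j with swap-position c j
  ... | moved eq comm
    rewrite eq | det-cong {M = minor N j} {minor M (swap c j)} (λ i k → cong (M (suc i)) (comm k))
    = neg-first (sign (toℕ (swap c j))) (M zero (swap c j)) (det (suc n) (minor M (swap c j)))
  ... | fixed eq c′ comm
    rewrite eq
          | trans (det-cong {M = minor N j} {λ i k → minor M j i (swap c′ k)}
                            (λ i k → cong (M (suc i)) (comm k)))
                  (det-swap c′ (minor M j))
    = neg-last (sign (toℕ j)) (M zero j) (det (suc n) (minor M j))

-- For a matrix with two equal adjacent columns, which a swap both fixes and negates in determinant.
-- The omitted cases equate integers of opposite sign.
x≡-x⇒x≡0 : ∀ x → x ≡ - x → x ≡ + 0
x≡-x⇒x≡0 (+ zero) _ = refl

-- The gap g between the two equal columns is closed by adjacent swaps.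
det-equal-columns-gap : ∀ {n} g (M : Matrix (suc n)) (a : Fin (suc n)) (b : Fin n) →
  toℕ b ≡ g + toℕ a → (∀ i → M i a ≡ M i (suc b)) → det (suc n) M ≡ + 0
det-equal-columns-gap {n} zero M a b b≡a eq = x≡-x⇒x≡0 _ (trans
  (sym (det-cong {M = λ i k → M i (swap b k)} λ i k → swap-invariant b (M i) (trans (cong (M i) (sym a≡b)) (eq i)) k))
  (det-swap b M))
  where
  a≡b : a ≡ inject₁ b
  a≡b = toℕ-injective (trans (sym b≡a) (sym (toℕ-inject₁ b)))
det-equal-columns-gap {suc n} (suc g) M a (suc b) b≡g+a eq = begin
  det (suc (suc n)) M      ≡⟨ ℤ.neg-involutive _ ⟨
  - (- det (suc (suc n)) M)  ≡⟨ cong -_ (det-swap (suc b) M) ⟨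
  - det (suc (suc n)) N    ≡⟨ cong -_ (det-equal-columns-gap g N a (inject₁ b)
                                        (trans (toℕ-inject₁ b) (ℕ.suc-injective b≡g+a)) N-equal) ⟩
  + 0 ∎
  where
  open ≡-Reasoning
  N : Matrix (suc (suc n))
  N i k = M i (swap (suc b) k)
  N-equal : ∀ i → N i a ≡ N i (suc (inject₁ b))
  N-equal i = trans (cong (M i) (swap-below (suc b) a
                      (subst (toℕ a <_) (sym b≡g+a) (s≤s (ℕ.m≤n+m (toℕ a) g)))))
             (trans (eq i) (cong (M i) (sym (swap-inject₁ (suc b)))))

det-equal-columns-< : ∀ {n} (M : Matrix n) (a b : Fin n) → toℕ a < toℕ b →
  (∀ i → M i a ≡ M i b) → det n M ≡ + 0
det-equal-columns-< M a (suc b) (s≤s a≤b) =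
  det-equal-columns-gap (toℕ b ∸ toℕ a) M a b (sym (ℕ.m∸n+n≡m a≤b))

det-equal-columns : ∀ {n} (M : Matrix n) (a b : Fin n) → a ≢ b →
  (∀ i → M i a ≡ M i b) → det n M ≡ + 0
det-equal-columns M a b a≢b eq with <-cmpᶠ a b
... | tri< a<b _ _ = det-equal-columns-< M a b a<b eq
... | tri≈ _ a≡b _ = contradiction a≡b a≢b
... | tri> _ _ b<a = det-equal-columns-< M b a b<a (sym ∘ eq)

_[_≔_] : ∀ {n} → Matrix n → Fin n → (Fin n → ℤ) → Matrix n
(M [ b ≔ v ]) i = updateAt (M i) b (const (v i))

≔-at : ∀ {n} (M : Matrix n) b v i → (M [ b ≔ v ]) i b ≡ v i
≔-at M b v i = updateAt-updates b (M i)

≔-away : ∀ {n} (M : Matrix n) b v i k → k ≢ b → (M [ b ≔ v ]) i k ≡ M i k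
≔-away M b v i k k≢b = updateAt-minimal k b (M i) k≢b

det-column-sum : ∀ {n} (M : Matrix n) (b : Fin n) m (x : Fin m → ℤ) (v : Fin m → Fin n → ℤ) →
  det n (M [ b ≔ (λ i → sumFin m (λ k → x k *ℤ v k i)) ]) ≡ sumFin m (λ k → x k *ℤ det n (M [ b ≔ v k ]))
det-column-sum {n} M b zero x v =
  -- A zero column is itself plus -1 times itself, so linearity with three copies of `Z` gives
  -- determinant `z - z` for `z` the determinant of `Z`.
  trans (det-linear b Z Z Z (- (+ 1)) (λ _ _ _ → refl) (λ _ _ _ → refl)
          (λ i → trans (≔-at M b (const (+ 0)) i) (sym (cancel (Z i b)))))
        (cancel (det n Z))
  where
  Z : Matrix n
  Z = M [ b ≔ const (+ 0) ]
  cancel : ∀ z → z +ℤ (- (+ 1)) *ℤ z ≡ + 0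
  cancel = solve-∀
det-column-sum {n} M b (suc m) x v =
  trans (det-linear b (M [ b ≔ total ]) (M [ b ≔ rest ]) (M [ b ≔ v zero ]) (x zero)
          (agree total rest) (agree (v zero) rest)
          (λ i → trans (≔-at M b total i) (trans (ℤ.+-comm (x zero *ℤ v zero i) (rest i))
                   (sym (cong₂ (λ y z → y +ℤ x zero *ℤ z) (≔-at M b rest i) (≔-at M b (v zero) i))))))
        (trans (cong (_+ℤ x zero *ℤ det n (M [ b ≔ v zero ])) (det-column-sum M b m (x ∘ suc) (v ∘ suc)))
               (ℤ.+-comm _ (x zero *ℤ det n (M [ b ≔ v zero ]))))
  where
  rest total : Fin n → ℤ
  rest i = sumFin m (λ k → x (suc k) *ℤ v (suc k) i)
  total i = x zero *ℤ v zero i +ℤ rest i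
  agree : ∀ u w i k → k ≢ b → (M [ b ≔ u ]) i k ≡ (M [ b ≔ w ]) i k
  agree u w i k k≢b = trans (≔-away M b u i k k≢b) (sym (≔-away M b w i k k≢b))

-- By multilinearity in column `b`, every summand other than the one at `b` repeats a column of `M`
-- and vanishes.
det-column-combination : ∀ {n} (M N : Matrix n) (b : Fin n) (x : Fin n → ℤ) →
  (∀ i k → k ≢ b → N i k ≡ M i k) → (∀ i → N i b ≡ sumFin n (λ k → x k *ℤ M i k)) →
  det n N ≡ x b *ℤ det n M
det-column-combination {n} M N b x away at-b = begin
  det n N
    ≡⟨ det-cong N≗ ⟩
  det n (M [ b ≔ combination ])
    ≡⟨ det-column-sum M b n x column ⟩
  sumFin n (λ k → x k *ℤ det n (M [ b ≔ column k ]))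
    ≡⟨ sumFin-only (λ k → x k *ℤ det n (M [ b ≔ column k ])) b
         (λ k k≢b → trans (cong (x k *ℤ_) (vanish k k≢b)) (ℤ.*-zeroʳ (x k))) ⟩
  x b *ℤ det n (M [ b ≔ column b ])
    ≡⟨ cong (x b *ℤ_) (det-cong same) ⟩
  x b *ℤ det n M ∎
  where
  open ≡-Reasoning
  column : Fin n → Fin n → ℤ
  column k i = M i k
  combination : Fin n → ℤ
  combination i = sumFin n (λ k → x k *ℤ M i k)
  N≗ : ∀ i k → N i k ≡ (M [ b ≔ combination ]) i k
  N≗ i k with k ≟ᶠ b
  ... | yes refl = trans (at-b i) (sym (≔-at M b combination i))
  ... | no k≢b   = trans (away i k k≢b) (sym (≔-away M b combination i k k≢b))
  same : ∀ i k → (M [ b ≔ column b ]) i k ≡ M i k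
  same i k with k ≟ᶠ b
  ... | yes refl = ≔-at M b (column b) i
  ... | no k≢b   = ≔-away M b (column b) i k k≢b
  vanish : ∀ k → k ≢ b → det n (M [ b ≔ column k ]) ≡ + 0
  vanish k k≢b = det-equal-columns (M [ b ≔ column k ]) k b k≢b λ i →
    trans (≔-away M b (column k) i k k≢b) (sym (≔-at M b (column k) i))

_·_ : ∀ {n} → Matrix n → Matrix n → Matrix n
_·_ {n} A V i j = sumFin n (λ k → A i k *ℤ V k j)

-- The columns of `A · V` are turned into those of `A` one by one from the left. When column `t` is
-- reached, it is a combination of columns up to `t`, which in the next hybrid are those of `A`, and
-- its own coefficient is 1, so the determinant is unchanged.
det-unitriangular : ∀ {n} (A V : Matrix n) → (∀ k → V k k ≡ + 1) →
  (∀ k j → toℕ j < toℕ k → V k j ≡ + 0) → det n (A · V) ≡ det n A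
det-unitriangular {n} A V diagonal below =
  trans (sweep n ℕ.≤-refl) (det-cong λ i j → hybrid-< n i j (toℕ<n j))
  where
  -- Columns below t are those of A, the others those of A · V.
  hybrid : ℕ → Matrix n
  hybrid t i j with toℕ j <? t
  ... | yes _ = A i j
  ... | no  _ = (A · V) i j

  hybrid-< : ∀ t i j → toℕ j < t → hybrid t i j ≡ A i j
  hybrid-< t i j j<t with toℕ j <? t
  ... | yes _  = refl
  ... | no j≮t = contradiction j<t j≮t

  hybrid-≮ : ∀ t i j → ¬ (toℕ j < t) → hybrid t i j ≡ (A · V) i j
  hybrid-≮ t i j j≮t with toℕ j <? t
  ... | yes j<t = contradiction j<t j≮t
  ... | no _    = refl

  step : ∀ t → t < n → det n (hybrid t) ≡ det n (hybrid (suc t))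
  step t t<n = begin
    det n (hybrid t)               ≡⟨ det-column-combination (hybrid (suc t)) (hybrid t) b (λ k → V k b) away at-b ⟩
    V b b *ℤ det n (hybrid (suc t)) ≡⟨ cong (_*ℤ det n (hybrid (suc t))) (diagonal b) ⟩
    + 1 *ℤ det n (hybrid (suc t))   ≡⟨ ℤ.*-identityˡ _ ⟩
    det n (hybrid (suc t))         ∎
    where
    open ≡-Reasoning
    b : Fin n
    b = fromℕ< t<n
    b≡t : toℕ b ≡ t
    b≡t = toℕ-fromℕ< t<n
    away : ∀ i k → k ≢ b → hybrid t i k ≡ hybrid (suc t) i k
    away i k k≢b with ℕ.<-cmp (toℕ k) t
    ... | tri< k<t _ _ = trans (hybrid-< t i k k<t) (sym (hybrid-< (suc t) i k (ℕ.m<n⇒m<1+n k<t)))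
    ... | tri≈ _ k≡t _ = contradiction (toℕ-injective (trans k≡t (sym b≡t))) k≢b
    ... | tri> k≮t _ t<k = trans (hybrid-≮ t i k k≮t) (sym (hybrid-≮ (suc t) i k (ℕ.≤⇒≯ t<k)))
    at-b : ∀ i → hybrid t i b ≡ sumFin n (λ k → V k b *ℤ hybrid (suc t) i k)
    at-b i = trans (hybrid-≮ t i b (ℕ.<-irrefl b≡t)) (sumFin-cong entry)
      where
      entry : ∀ k → A i k *ℤ V k b ≡ V k b *ℤ hybrid (suc t) i k
      entry k with toℕ k <? suc t
      ... | yes _   = ℤ.*-comm (A i k) (V k b)
      -- To the right of `t` the hybrid holds columns of `A · V` instead of `A`, but there the
      -- coefficient is 0.
      ... | no k≮t rewrite below k b (subst (_< toℕ k) (sym b≡t) (ℕ.≮⇒≥ k≮t)) = ℤ.*-zeroʳ (A i k)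

  sweep : ∀ t → t ≤ n → det n (A · V) ≡ det n (hybrid t)
  sweep zero    _   = det-cong λ i j → sym (hybrid-≮ 0 i j λ ())
  sweep (suc t) t<n = trans (sweep t (ℕ.<⇒≤ t<n)) (step t t<n)

-- Jacobi matrices and continuants

tail : (ℕ → ℤ) → ℕ → ℤ
tail c k = c (suc k)

jacobi : (ℕ → ℤ) → (ℕ → ℤ) → ℕ → ℤ
jacobi c v zero    = c 0 *ℤ v 0 +ℤ v 1
jacobi c v (suc k) = v k +ℤ c (suc k) *ℤ v (suc k) +ℤ v (suc (suc k))

-- The leading minor of `T`, expanded from its upper left corner, to match the expansion of `det`
-- along row 0.
continuant : (ℕ → ℤ) → ℕ → ℤ
continuant c zero          = + 1
continuant c (suc zero)    = c 0
continuant c (suc (suc n)) = c 0 *ℤ continuant (tail c) (suc n) - continuant (tail (tail c)) n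

-- The same minor expanded from its lower right corner, so that `c` stays fixed while `n` grows.
-- Induction expands both smaller continuants at their last entry; regrouping exchanges the two
-- ends.
continuant-last : ∀ c n → continuant c (suc (suc n)) ≡ c (suc n) *ℤ continuant c (suc n) - continuant c n
continuant-last c zero = cong (_- + 1) (ℤ.*-comm (c 0) (c 1))
continuant-last c (suc zero) = rearrange (c 0) (c 1) (c 2)
  where
  rearrange : ∀ x y z → x *ℤ (y *ℤ z - + 1) - z ≡ z *ℤ (x *ℤ y - + 1) - x
  rearrange = solve-∀
continuant-last c (suc (suc n)) =
  trans (cong₂ (λ y z → c 0 *ℤ y - z) (continuant-last (tail c) (suc n)) (continuant-last (tail (tail c)) n))
        (rearrange (c 0) (c (suc (suc (suc n)))) (continuant (tail c) (suc (suc n)))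
                   (continuant (tail c) (suc n)) (continuant (tail (tail c)) (suc n))
                   (continuant (tail (tail c)) n))
  where
  rearrange : ∀ x w a b d e → x *ℤ (w *ℤ a - b) - (w *ℤ d - e) ≡ w *ℤ (x *ℤ a - d) - (x *ℤ b - e)
  rearrange = solve-∀

record Unitriangular (u : ℕ → ℕ → ℤ) : Set where
  field
    diagonal : ∀ k → u k k ≡ + 1
    above    : ∀ i k → i < k → u i k ≡ + 0

open Unitriangular

shift : (ℕ → ℕ → ℤ) → ℕ → ℕ → ℤ
shift u i k = u (suc i) (suc k)

shift-unitriangular : ∀ {u} → Unitriangular u → Unitriangular (shift u)
shift-unitriangular U .diagonal k    = diagonal U (suc k)
shift-unitriangular U .above i k i<k = above U (suc i) (suc k) (s≤s i<k)

-- Row `i` is `T uᵢ` with its coordinate 0 replaced by an arbitrary `x i`. The minors met below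
-- differ from one another only in this first column, so the family is closed under expansion.
bordered : ∀ n → (ℕ → ℤ) → (ℕ → ℤ) → (ℕ → ℕ → ℤ) → Matrix n
bordered (suc n) x c u i zero    = x (toℕ i)
bordered (suc n) x c u i (suc j) = jacobi c (u (toℕ i)) (suc (toℕ j))

-- As `u 0` is the unit vector at 0, row 0 reads `x 0`, 1, 0, 0, and so on. Only two minors survive,
-- both bordered for `tail c` and `shift u`.
det-bordered-expand : ∀ n x c {u} → Unitriangular u →
  det (suc (suc n)) (bordered (suc (suc n)) x c u) ≡
  x 0 *ℤ det (suc n) (bordered (suc n) (λ i → jacobi c (u (suc i)) 1) (tail c) (shift u)) -
  det (suc n) (bordered (suc n) (tail x) (tail c) (shift u))
det-bordered-expand n x c {u} U =
  trans (cong₂ (λ p q → + 1 *ℤ (x 0 *ℤ p) +ℤ q)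
          (det-cong {M = minor B zero} {first} λ { i zero → refl ; i (suc k) → refl })
          (cong₂ _+ℤ_
            (cong₂ (λ p q → - (+ 1) *ℤ (p *ℤ q)) second
              (det-cong {M = minor B (suc zero)} {bordered (suc n) (tail x) (tail c) (shift u)} λ { i zero → refl ; i (suc k) → refl }))
            (sumFin-zero {n} λ j → trans (cong (sign (toℕ (suc (suc j))) *ℤ_)
              (trans (cong (_*ℤ det (suc n) (minor B (suc (suc j)))) (later j)) (ℤ.*-zeroˡ (det (suc n) (minor B (suc (suc j)))))))
              (ℤ.*-zeroʳ (sign (toℕ (suc (suc j))))))))
        (tidy (x 0) (det (suc n) first) (det (suc n) (bordered (suc n) (tail x) (tail c) (shift u))))
  where
  first : Matrix (suc n)
  first = bordered (suc n) (λ i → jacobi c (u (suc i)) 1) (tail c) (shift u)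
  B : Matrix (suc (suc n))
  B = bordered (suc (suc n)) x c u
  tidy : ∀ a p q → + 1 *ℤ (a *ℤ p) +ℤ (- (+ 1) *ℤ (+ 1 *ℤ q) +ℤ + 0) ≡ a *ℤ p - q
  tidy = solve-∀
  second : jacobi c (u 0) 1 ≡ + 1
  second rewrite diagonal U 0 | above U 0 1 (s≤s z≤n) | above U 0 2 (s≤s z≤n) | ℤ.*-zeroʳ (c 1) = refl
  later : ∀ (j : Fin n) → jacobi c (u 0) (suc (suc (toℕ j))) ≡ + 0
  later j rewrite above U 0 (1 + toℕ j) (s≤s z≤n) | above U 0 (2 + toℕ j) (s≤s z≤n)
                | above U 0 (3 + toℕ j) (s≤s z≤n) | ℤ.*-zeroʳ (c (2 + toℕ j)) = refl

det-bordered-linear : ∀ n x y z α c u → (∀ i → x i ≡ y i +ℤ α *ℤ z i) →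
  det (suc n) (bordered (suc n) x c u) ≡
  det (suc n) (bordered (suc n) y c u) +ℤ α *ℤ det (suc n) (bordered (suc n) z c u)
det-bordered-linear n x y z α c u eq =
  det-linear zero (bordered (suc n) x c u) (bordered (suc n) y c u) (bordered (suc n) z c u) α
    (agree x y) (agree z y) (λ i → eq (toℕ i))
  where
  agree : ∀ x y i k → k ≢ zero → bordered (suc n) x c u i k ≡ bordered (suc n) y c u i k
  agree x y i zero    k≢0 = contradiction refl k≢0
  agree x y i (suc k) k≢0 = refl

triangularJacobi : ∀ n → (ℕ → ℤ) → (ℕ → ℕ → ℤ) → Matrix n
triangularJacobi n c u = bordered n (λ i → jacobi c (u i) 0) c u

-- Column 1 of the Jacobi product is column 0 of the shifted one plus column 0 of u.
det-column₁ : ∀ n c u →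
  det (suc n) (bordered (suc n) (λ i → jacobi c (u (suc i)) 1) (tail c) (shift u)) ≡
  det (suc n) (triangularJacobi (suc n) (tail c) (shift u)) +ℤ
  + 1 *ℤ det (suc n) (bordered (suc n) (λ i → u (suc i) 0) (tail c) (shift u))
det-column₁ n c u = det-bordered-linear n
  (λ i → jacobi c (u (suc i)) 1) (λ i → jacobi (tail c) (shift u i) 0) (λ i → u (suc i) 0) (+ 1) (tail c) (shift u)
  λ i → rearrange (u (suc i) 0) (c 1 *ℤ u (suc i) 1) (u (suc i) 2)
  where
  rearrange : ∀ x y z → x +ℤ y +ℤ z ≡ y +ℤ z +ℤ + 1 *ℤ x
  rearrange = solve-∀

-- Subtracting column 0 from column 1 would leave row 0 as 1, 0, 0, and so on, above a block of the
-- same kind for `tail c` and `shift u`. In the expansion this shows as the cancellation of `d`.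
det-bordered-column : ∀ n c {u} → Unitriangular u →
  det (suc n) (bordered (suc n) (λ i → u i 0) c u) ≡ det n (triangularJacobi n (tail c) (shift u))
det-bordered-column zero    c U rewrite diagonal U 0 = refl
det-bordered-column (suc n) c {u} U = begin
  det (suc (suc n)) (bordered (suc (suc n)) (λ i → u i 0) c u)
    ≡⟨ det-bordered-expand n (λ i → u i 0) c U ⟩
  u 0 0 *ℤ det (suc n) (bordered (suc n) (λ i → jacobi c (u (suc i)) 1) (tail c) (shift u)) - d
    ≡⟨ cong₂ (λ y z → y *ℤ z - d) (diagonal U 0) (det-column₁ n c u) ⟩
  + 1 *ℤ (t +ℤ + 1 *ℤ d) - d
    ≡⟨ cancel t d ⟩
  t ∎
  where
  open ≡-Reasoning
  d t : ℤ
  d = det (suc n) (bordered (suc n) (λ i → u (suc i) 0) (tail c) (shift u))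
  t = det (suc n) (triangularJacobi (suc n) (tail c) (shift u))
  cancel : ∀ t d → + 1 *ℤ (t +ℤ + 1 *ℤ d) - d ≡ t
  cancel = solve-∀

-- A unitriangular left factor does not change the leading minors of `T`. In the expansion, the part
-- `d` coming from column 0 of `u` occurs with factor `c 0` in both minors and cancels, leaving the
-- continuant recurrence.
det-triangularJacobi : ∀ n c {u} → Unitriangular u → det n (triangularJacobi n c u) ≡ continuant c n
det-triangularJacobi zero c U = refl
det-triangularJacobi (suc zero) c U
  rewrite diagonal U 0 | above U 0 1 (s≤s z≤n) = tidy (c 0)
  where
  tidy : ∀ x → + 1 *ℤ ((x *ℤ + 1 +ℤ + 0) *ℤ + 1) +ℤ + 0 ≡ x
  tidy = solve-∀
det-triangularJacobi (suc (suc n)) c {u} U = begin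
  det (suc (suc n)) (triangularJacobi (suc (suc n)) c u)
    ≡⟨ det-bordered-expand n (λ i → jacobi c (u i) 0) c U ⟩
  jacobi c (u 0) 0 *ℤ det (suc n) (bordered (suc n) (λ i → jacobi c (u (suc i)) 1) (tail c) (shift u)) -
  det (suc n) (bordered (suc n) (λ i → jacobi c (u (suc i)) 0) (tail c) (shift u))
    ≡⟨ cong₂ _-_ (cong₂ _*ℤ_ corner (det-column₁ n c u))
         (det-bordered-linear n (λ i → jacobi c (u (suc i)) 0) (λ i → u (suc i) 1) (λ i → u (suc i) 0) (c 0) (tail c) (shift u)
           (λ i → ℤ.+-comm (c 0 *ℤ u (suc i) 0) (u (suc i) 1))) ⟩
  c 0 *ℤ (t +ℤ + 1 *ℤ d) - (e +ℤ c 0 *ℤ d)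
    ≡⟨ cancel (c 0) t d e ⟩
  c 0 *ℤ t - e
    ≡⟨ cong₂ (λ y z → c 0 *ℤ y - z)
         (det-triangularJacobi (suc n) (tail c) (shift-unitriangular U))
         (trans (det-bordered-column n (tail c) (shift-unitriangular U))
                (det-triangularJacobi n (tail (tail c)) (shift-unitriangular (shift-unitriangular U)))) ⟩
  continuant c (suc (suc n)) ∎
  where
  open ≡-Reasoning
  d t e : ℤ
  d = det (suc n) (bordered (suc n) (λ i → u (suc i) 0) (tail c) (shift u))
  t = det (suc n) (triangularJacobi (suc n) (tail c) (shift u))
  e = det (suc n) (bordered (suc n) (λ i → u (suc i) 1) (tail c) (shift u))
  corner : jacobi c (u 0) 0 ≡ c 0
  corner rewrite diagonal U 0 | above U 0 1 (s≤s z≤n) = tidy (c 0)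
    where
    tidy : ∀ x → x *ℤ + 1 +ℤ + 0 ≡ x
    tidy = solve-∀
  cancel : ∀ x t d e → x *ℤ (t +ℤ + 1 *ℤ d) - (e +ℤ x *ℤ d) ≡ x *ℤ t - e
  cancel = solve-∀

-- Moments

-- The vectors `uᵢ`: each is `T` applied to the previous one with coordinate 0 cleared. The cleared
-- value is kept as `moment`.
path : (ℕ → ℤ) → ℕ → ℕ → ℤ
path c zero    zero    = + 1
path c zero    (suc k) = + 0
path c (suc i) zero    = + 0
path c (suc i) (suc k) = jacobi c (path c i) (suc k)

moment : (ℕ → ℤ) → ℕ → ℤ
moment c i = jacobi c (path c i) 0

path-unitriangular : ∀ c → Unitriangular (path c)
path-unitriangular c .above zero    (suc k) _ = refl
path-unitriangular c .above (suc i) (suc k) (s≤s i<k)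
  rewrite path-unitriangular c .above i k i<k
        | path-unitriangular c .above i (1 + k) (ℕ.m<n⇒m<1+n i<k)
        | path-unitriangular c .above i (2 + k) (ℕ.m<n⇒m<1+n (ℕ.m<n⇒m<1+n i<k))
        | ℤ.*-zeroʳ (c (suc k)) = refl
path-unitriangular c .diagonal zero    = refl
path-unitriangular c .diagonal (suc k)
  rewrite path-unitriangular c .diagonal k
        | path-unitriangular c .above k (1 + k) ℕ.≤-refl
        | path-unitriangular c .above k (2 + k) (ℕ.m<n⇒m<1+n ℕ.≤-refl)
        | ℤ.*-zeroʳ (c (suc k)) = refl

-- A discrete Green formula: `T` is symmetric, and cutting it off between coordinates `m` and
-- `suc m` leaves one boundary product on each side.
jacobi-green : ∀ c (x y : ℕ → ℤ) m →
  sumFin (suc m) (λ k → jacobi c x (toℕ k) *ℤ y (toℕ k)) +ℤ x m *ℤ y (suc m) ≡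
  sumFin (suc m) (λ k → jacobi c y (toℕ k) *ℤ x (toℕ k)) +ℤ x (suc m) *ℤ y m
jacobi-green c x y zero = rearrange (c 0) (x 0) (x 1) (y 0) (y 1)
  where
  rearrange : ∀ c x₀ x₁ y₀ y₁ →
    (c *ℤ x₀ +ℤ x₁) *ℤ y₀ +ℤ + 0 +ℤ x₀ *ℤ y₁ ≡ (c *ℤ y₀ +ℤ y₁) *ℤ x₀ +ℤ + 0 +ℤ x₁ *ℤ y₀
  rearrange = solve-∀
jacobi-green c x y (suc m)
  rewrite sumFin-last (suc m) (λ k → jacobi c x k *ℤ y k)
        | sumFin-last (suc m) (λ k → jacobi c y k *ℤ x k) =
  trans (pull (sumFin (suc m) (λ k → jacobi c x (toℕ k) *ℤ y (toℕ k))) (c (suc m)) (x m) (x (1 + m)) (x (2 + m)) (y (1 + m)) (y (2 + m)))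
        (trans (cong (_+ℤ (c (suc m) *ℤ x (1 + m) *ℤ y (1 + m) +ℤ x (2 + m) *ℤ y (1 + m) +ℤ x (1 + m) *ℤ y (2 + m)))
                     (jacobi-green c x y m))
               (push (sumFin (suc m) (λ k → jacobi c y (toℕ k) *ℤ x (toℕ k))) (c (suc m)) (x (1 + m)) (x (2 + m)) (y m) (y (1 + m)) (y (2 + m))))
  where
  pull : ∀ s c x₀ x₁ x₂ y₁ y₂ →
    s +ℤ (x₀ +ℤ c *ℤ x₁ +ℤ x₂) *ℤ y₁ +ℤ x₁ *ℤ y₂ ≡
    s +ℤ x₀ *ℤ y₁ +ℤ (c *ℤ x₁ *ℤ y₁ +ℤ x₂ *ℤ y₁ +ℤ x₁ *ℤ y₂)
  pull = solve-∀
  push : ∀ s c x₁ x₂ y₀ y₁ y₂ →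
    s +ℤ x₁ *ℤ y₀ +ℤ (c *ℤ x₁ *ℤ y₁ +ℤ x₂ *ℤ y₁ +ℤ x₁ *ℤ y₂) ≡
    s +ℤ (y₀ +ℤ c *ℤ y₁ +ℤ y₂) *ℤ x₁ +ℤ x₂ *ℤ y₁
  push = solve-∀

-- Self-adjointness moves one application of `T` from `uᵢ₊₁` over to `uⱼ`, lowering `i` and raising
-- `j` until `u₀` picks out coordinate 0. The boundary products vanish because `uᵢ` is supported on
-- coordinates up to `i`.
moment-inner : ∀ c i j n → i < n →
  sumFin n (λ k → jacobi c (path c j) (toℕ k) *ℤ path c i (toℕ k)) ≡ moment c (i + j)
moment-inner c zero j (suc m) (s≤s _) =
  trans (cong (moment c j *ℤ + 1 +ℤ_) (sumFin-zero {m} λ k → ℤ.*-zeroʳ (jacobi c (path c j) (suc (toℕ k)))))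
        (tidy (moment c j))
  where
  tidy : ∀ x → x *ℤ + 1 +ℤ + 0 ≡ x
  tidy = solve-∀
moment-inner c (suc i) j (suc m) (s≤s i<m) = begin
  sumFin (suc m) (λ k → jacobi c (path c j) (toℕ k) *ℤ path c (suc i) (toℕ k))
    -- Coordinate 0 contributes 0 on both sides; elsewhere `path c (suc i)` is `T uᵢ` and `T uⱼ` is
    -- `path c (suc j)`.
    ≡⟨ cong₂ _+ℤ_ (trans (ℤ.*-zeroʳ (moment c j)) (sym (ℤ.*-zeroʳ (moment c i))))
         (sumFin-cong {m} λ k → ℤ.*-comm (jacobi c (path c j) (suc (toℕ k))) (jacobi c (path c i) (suc (toℕ k)))) ⟩
  left
    ≡⟨ drop (path c (suc j) (suc m)) (above (path-unitriangular c) i m i<m) ⟨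
  left +ℤ path c i m *ℤ path c (suc j) (suc m)
    ≡⟨ jacobi-green c (path c i) (path c (suc j)) m ⟩
  right +ℤ path c i (suc m) *ℤ path c (suc j) m
    ≡⟨ drop (path c (suc j) m) (above (path-unitriangular c) i (suc m) (ℕ.m<n⇒m<1+n i<m)) ⟩
  right
    ≡⟨ moment-inner c i (suc j) (suc m) (ℕ.m<n⇒m<1+n i<m) ⟩
  moment c (i + suc j)
    ≡⟨ cong (moment c) (ℕ.+-suc i j) ⟩
  moment c (suc i + j) ∎
  where
  open ≡-Reasoning
  left right : ℤ
  left  = sumFin (suc m) (λ k → jacobi c (path c i) (toℕ k) *ℤ path c (suc j) (toℕ k))
  right = sumFin (suc m) (λ k → jacobi c (path c (suc j)) (toℕ k) *ℤ path c i (toℕ k))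
  drop : ∀ {s x} y → x ≡ + 0 → s +ℤ x *ℤ y ≡ s
  drop {s} y refl = ℤ.+-identityʳ s

hankel-cong : ∀ {f g : ℕ → ℤ} → (∀ k → f k ≡ g k) → ∀ n → hankel f n ≡ hankel g n
hankel-cong f≗g n = det-cong {n} λ i j → f≗g (toℕ i + toℕ j)

-- Here `W` is `U T` and `V` is the transpose of `U`. Truncation to `n` coordinates loses nothing,
-- since the vectors with index below `n` vanish from coordinate `n` on.
hankel-moment : ∀ c n → hankel (moment c) n ≡ continuant c n
hankel-moment c n = begin
  hankel (moment c) n ≡⟨ det-cong entry ⟩
  det n (W · V)       ≡⟨ det-unitriangular W V (λ k → diagonal (path-unitriangular c) (toℕ k))
                           (λ k j → above (path-unitriangular c) (toℕ j) (toℕ k)) ⟩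
  det n W             ≡⟨ det-cong (W≗ n) ⟩
  det n (triangularJacobi n c (path c)) ≡⟨ det-triangularJacobi n c (path-unitriangular c) ⟩
  continuant c n      ∎
  where
  open ≡-Reasoning
  W V : Matrix n
  W i k = jacobi c (path c (toℕ i)) (toℕ k)
  V k j = path c (toℕ j) (toℕ k)
  entry : ∀ i j → moment c (toℕ i + toℕ j) ≡ (W · V) i j
  entry i j = trans (cong (moment c) (ℕ.+-comm (toℕ i) (toℕ j)))
                    (sym (moment-inner c (toℕ j) (toℕ i) n (toℕ<n j)))
  W≗ : ∀ n (i k : Fin n) → jacobi c (path c (toℕ i)) (toℕ k) ≡ triangularJacobi n c (path c) i k
  W≗ (suc n) i zero    = refl
  W≗ (suc n) i (suc k) = refl

-- Counting Dyck paths

count : (List Step → Bool) → ℕ → ℕ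
count P n = length (filterᵇ P (words n))

length-filterᵇ-map : ∀ (P : List Step → Bool) (f : List Step → List Step) ws →
  length (filterᵇ P (map f ws)) ≡ length (filterᵇ (P ∘ f) ws)
length-filterᵇ-map P f []       = refl
length-filterᵇ-map P f (w ∷ ws) with P (f w)
... | true  = cong suc (length-filterᵇ-map P f ws)
... | false = length-filterᵇ-map P f ws

length-filterᵇ-cong : ∀ {P Q : List Step → Bool} → (∀ w → P w ≡ Q w) →
  ∀ ws → length (filterᵇ P ws) ≡ length (filterᵇ Q ws)
length-filterᵇ-cong P≗Q [] = refl
length-filterᵇ-cong {P} {Q} P≗Q (w ∷ ws) with P w | Q w | P≗Q w
... | true  | true  | refl = cong suc (length-filterᵇ-cong P≗Q ws)
... | false | false | refl = length-filterᵇ-cong P≗Q ws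

length-filterᵇ-none : ∀ (ws : List (List Step)) → length (filterᵇ (const false) ws) ≡ 0
length-filterᵇ-none []       = refl
length-filterᵇ-none (w ∷ ws) = length-filterᵇ-none ws

count-suc : ∀ P {Q R : List Step → Bool} n → (∀ w → P (true ∷ w) ≡ Q w) → (∀ w → P (false ∷ w) ≡ R w) →
  count P (suc n) ≡ count Q n + count R n
count-suc P {Q} {R} n up down = begin
  length (filterᵇ P (map (true ∷_) ws ++ map (false ∷_) ws))
    ≡⟨ cong length (filter-++ (T? ∘ P) (map (true ∷_) ws) (map (false ∷_) ws)) ⟩
  length (filterᵇ P (map (true ∷_) ws) ++ filterᵇ P (map (false ∷_) ws))
    ≡⟨ length-++ (filterᵇ P (map (true ∷_) ws)) ⟩
  length (filterᵇ P (map (true ∷_) ws)) + length (filterᵇ P (map (false ∷_) ws))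
    ≡⟨ cong₂ _+_ (trans (length-filterᵇ-map P (true ∷_) ws) (length-filterᵇ-cong up ws))
                 (trans (length-filterᵇ-map P (false ∷_) ws) (length-filterᵇ-cong down ws)) ⟩
  count Q n + count R n ∎
  where
  open ≡-Reasoning
  ws : List (List Step)
  ws = words n

-- `peakHeights` looks two steps ahead. Remembering that the previous step went up lets the
-- recursion read one step at a time.
peakHeightsAfterUp : ℕ → List Step → List ℕ
peakHeightsAfterUp h []          = []
peakHeightsAfterUp h (true ∷ w)  = peakHeightsAfterUp (suc h) w
peakHeightsAfterUp h (false ∷ w) = h ∷ peakHeights (h ∸ 1) w

peakHeights-up : ∀ h w → peakHeights h (true ∷ w) ≡ peakHeightsAfterUp (suc h) w
peakHeights-up h []          = refl
peakHeights-up h (true ∷ w)  = peakHeights-up (suc h) w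
peakHeights-up h (false ∷ w) = refl

dyckFrom-up : ∀ h w → dyckFrom h (true ∷ w) ≡ dyckFrom (suc h) w
dyckFrom-up zero    w = refl
dyckFrom-up (suc h) w = refl

-- The number of ways to leave an odd height and be back after two steps: through the valley below,
-- always, and through the peak above unless its height is forbidden (`true`).
weight : Bool → ℤ
weight true  = + 1
weight false = + 2

-- Forbidden peaks have even height, so steps are taken in pairs: level k is height 2k, and path c i k (i ≥ 1)
-- counts the admissible words of length 2i from height 2k whose first step is down.
module Counting (q : ℕ → Bool) (q-odd : ∀ k → q (suc (k * 2)) ≡ false) where

  valid validAfterUp : ℕ → List Step → Bool
  valid h w        = dyckFrom h w ∧ not (any q (peakHeights h w))
  validAfterUp h w = dyckFrom h w ∧ not (any q (peakHeightsAfterUp h w))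

  valid-up : ∀ h w → valid h (true ∷ w) ≡ validAfterUp (suc h) w
  valid-up h w rewrite peakHeights-up h w | dyckFrom-up h w = refl

  N N↑ : ℕ → ℕ → ℤ
  N  h n = + count (valid h) n
  N↑ h n = + count (validAfterUp h) n

  N-ground : ∀ n → N 0 (suc n) ≡ N↑ 1 n
  N-ground n = cong +_ (trans
    (count-suc (valid 0) {validAfterUp 1} {const false} n (valid-up 0) (λ w → refl))
    (trans (cong (λ z → count (validAfterUp 1) n + z) (length-filterᵇ-none (words n))) (ℕ.+-identityʳ _)))

  N-step : ∀ h n → N (suc h) (suc n) ≡ N↑ (suc (suc h)) n +ℤ N h n
  N-step h n = cong +_ (count-suc (valid (suc h)) n (valid-up (suc h)) (λ w → refl))

  -- A down-step here completes a peak at `suc h`, so the factor is 0 if that height is forbidden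
  -- and 1 otherwise.
  N↑-step : ∀ h n → N↑ (suc h) (suc n) ≡ N↑ (suc (suc h)) n +ℤ (weight (q (suc h)) - + 1) *ℤ N h n
  N↑-step h n with q (suc h) in eq
  ... | true  = cong +_ (trans
                  (count-suc (validAfterUp (suc h)) {validAfterUp (suc (suc h))} {const false} n (λ w → refl) down)
                  (cong (λ z → count (validAfterUp (suc (suc h))) n + z) (length-filterᵇ-none (words n))))
    where
    down : ∀ w → validAfterUp (suc h) (false ∷ w) ≡ false
    down w rewrite eq = ∧-zeroʳ (dyckFrom h w)
  ... | false = trans (cong +_ (count-suc (validAfterUp (suc h)) {validAfterUp (suc (suc h))} {valid h} n
                  (λ w → refl) down))
                (cong (N↑ (suc (suc h)) n +ℤ_) (sym (ℤ.*-identityˡ (N h n))))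
    where
    down : ∀ w → validAfterUp (suc h) (false ∷ w) ≡ valid h w
    down w rewrite eq = refl

  c : ℕ → ℤ
  -- Coordinate 0 of `path c i` vanishes for `i ≥ 1`, so this entry enters only `moment c 0`, which
  -- counts the empty path.
  c zero    = + 1
  c (suc k) = weight (q (suc k * 2))

  u : ℕ → ℕ → ℤ
  u = path c

  -- No peak at odd height is forbidden, so there the direction of the previous step is irrelevant.
  N↑-odd : ∀ k n → N↑ (suc (k * 2)) (suc n) ≡ N (suc (k * 2)) (suc n)
  N↑-odd k n = trans (N↑-step (k * 2) n) (trans
    (cong (λ b → N↑ (suc (suc (k * 2))) n +ℤ (weight b - + 1) *ℤ N (k * 2) n) (q-odd k))
    (trans (cong (N↑ (suc (suc (k * 2))) n +ℤ_) (ℤ.*-identityˡ (N (k * 2) n))) (sym (N-step (k * 2) n))))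

  -- For `i ≥ 1` the two summands are the words beginning with down and with up. An up-step reaches
  -- odd height `2k+1`, where one may equally have come down from level `suc k`. The three
  -- statements are proved together by induction on word length.
  N-even : ∀ i k → N (k * 2) (i * 2) ≡ u i k +ℤ u i (suc k)
  N-odd  : ∀ i k → N (suc (k * 2)) (suc (i * 2)) ≡ u (suc i) (suc k)
  N↑-even : ∀ i k → N↑ (suc k * 2) (i * 2) ≡ (c (suc k) - + 1) *ℤ u i (suc k) +ℤ u i (suc (suc k))

  N-even zero    zero    = refl
  N-even zero    (suc k) = refl
  N-even (suc i) zero    =
    trans (N-ground (suc (i * 2))) (trans (N↑-odd 0 (i * 2)) (trans (N-odd i 0) (sym (ℤ.+-identityˡ _))))
  N-even (suc i) (suc k) =
    trans (N-step (suc (k * 2)) (suc (i * 2)))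
          (trans (cong₂ _+ℤ_ (trans (N↑-odd (suc k) (i * 2)) (N-odd i (suc k))) (N-odd i k))
                 (ℤ.+-comm (u (suc i) (suc (suc k))) (u (suc i) (suc k))))

  N-odd i k =
    trans (N-step (k * 2) (i * 2))
          (trans (cong₂ _+ℤ_ (N↑-even i k) (N-even i k))
                 (rearrange (c (suc k)) (u i k) (u i (suc k)) (u i (suc (suc k)))))
    where
    rearrange : ∀ c x y z → (c - + 1) *ℤ y +ℤ z +ℤ (x +ℤ y) ≡ x +ℤ c *ℤ y +ℤ z
    rearrange = solve-∀

  N↑-even zero    k = sym (trans (ℤ.+-identityʳ _) (ℤ.*-zeroʳ (c (suc k) - + 1)))
  N↑-even (suc i) k =
    trans (N↑-step (suc (k * 2)) (suc (i * 2)))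
          (trans (cong₂ (λ x y → x +ℤ (c (suc k) - + 1) *ℤ y)
                        (trans (N↑-odd (suc k) (i * 2)) (N-odd i (suc k))) (N-odd i k))
                 (ℤ.+-comm (u (suc i) (suc (suc k))) _))

  N-moment : ∀ i → N 0 (2 * i) ≡ moment c i
  N-moment i =
    trans (cong (N 0) (ℕ.*-comm 2 i))
          (trans (N-even i 0) (cong (_+ℤ u i 1) (sym (ℤ.*-identityˡ (u i 0)))))

-- Forbidden levels modulo the period, and the sections

%-≡⇒∣ : ∀ x d n .{{_ : NonZero n}} → (x + d) % n ≡ x % n → n ∣ d
%-≡⇒∣ x d n eq = ∣m+n∣m⇒∣n (divides ((x + d) / n) (ℕ.+-cancelˡ-≡ (x % n) _ _ cancelled)) (divides (x / n) refl)
  where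
  open ≡-Reasoning
  cancelled : x % n + (x / n * n + d) ≡ x % n + (x + d) / n * n
  cancelled = begin
    x % n + (x / n * n + d)           ≡⟨ ℕ.+-assoc (x % n) (x / n * n) d ⟨
    x % n + x / n * n + d             ≡⟨ cong (_+ d) (m≡m%n+[m/n]*n x n) ⟨
    x + d                             ≡⟨ m≡m%n+[m/n]*n (x + d) n ⟩
    (x + d) % n + (x + d) / n * n     ≡⟨ cong (_+ (x + d) / n * n) eq ⟩
    x % n + (x + d) / n * n           ∎

module Sections (p′ s′ : ℕ) (s≤p : suc s′ ≤ suc p′) where

  p s : ℕ
  p = suc p′
  s = suc s′

  q : ℕ → Bool
  q = inMV (2 * p) (2 * s ∷ [])

  q-false : ∀ h → (h % (2 * p) ≢ 2 * s % (2 * p)) → q h ≡ false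
  q-false zero    _  = refl
  q-false (suc h) h≢ with (suc h % (2 * p)) ≡ᵇ (2 * s % (2 * p)) in eq
  ... | true  = contradiction (ℕ.≡ᵇ⇒≡ _ _ (subst T (sym eq) _)) h≢
  ... | false = refl

  q-true : ∀ h → (suc h % (2 * p) ≡ 2 * s % (2 * p)) → q (suc h) ≡ true
  q-true h eq with (suc h % (2 * p)) ≡ᵇ (2 * s % (2 * p)) | ℕ.≡⇒≡ᵇ _ _ eq
  ... | true | _ = refl

  -- Modulus and residue are both even, so every forbidden height is even.
  q-odd : ∀ k → q (suc (k * 2)) ≡ false
  q-odd k = q-false (suc (k * 2)) λ eq → 2∤1 (∣m+n∣m⇒∣n
      (subst (2 ∣_) (ℕ.+-comm 1 (k * 2)) (∣n∣m%n⇒∣m 2∣2p (subst (2 ∣_) (sym eq) (%-presˡ-∣ (divides s (ℕ.*-comm 2 s)) 2∣2p))))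
      (divides k refl))
    where
    2∣2p : 2 ∣ 2 * p
    2∣2p = divides p (ℕ.*-comm 2 p)
    2∤1 : ¬ (2 ∣ 1)
    2∤1 2∣1 with ∣⇒≤ 2∣1
    ... | s≤s ()

  open Counting q q-odd

  2p∤ : ∀ i → suc i < p → ¬ (2 * p ∣ suc i * 2)
  2p∤ i i<p 2p∣ = ℕ.<⇒≱ i<p (ℕ.*-cancelˡ-≤ 2 (subst (2 * p ≤_) (ℕ.*-comm (suc i) 2) (∣⇒≤ 2p∣)))

  -- The gap between heights `2(k+1)` and `2s` is positive and, as `s ≤ p`, below `2p`; hence they
  -- are not congruent.
  c-initial : ∀ k → suc k < s → c (suc k) ≡ + 2
  c-initial k k<s with ℕ.m≤n⇒∃[o]m+o≡n k<s
  ... | d , eq = cong weight (q-false (suc k * 2) λ same →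
      2p∤ d (ℕ.<-≤-trans (subst (suc d <_) eq′ (s≤s (ℕ.m≤n+m (suc d) k))) s≤p)
        (%-≡⇒∣ (suc k * 2) (suc d * 2) (2 * p) (trans (cong (_% (2 * p)) split) (sym same))))
    where
    eq′ : suc k + suc d ≡ s
    eq′ = trans (ℕ.+-suc (suc k) d) eq
    split : suc k * 2 + suc d * 2 ≡ 2 * s
    split = trans (sym (ℕ.*-distribʳ-+ 2 (suc k) (suc d))) (trans (cong (_* 2) eq′) (ℕ.*-comm s 2))

  residue : ∀ j i → (s + j * p + i) * 2 % (2 * p) ≡ (2 * s + i * 2) % (2 * p)
  residue j i = trans (cong (_% (2 * p)) (rearrange s j p i)) ([m+kn]%n≡m%n (2 * s + i * 2) j (2 * p))
    where
    rearrange : ∀ s j p i → (s + j * p + i) * 2 ≡ 2 * s + i * 2 + j * (2 * p)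
    rearrange = solve-∀ᴺ

  c-end : ∀ j → c (s + j * p) ≡ + 1
  c-end j = cong weight (q-true _ (trans (cong (λ z → z * 2 % (2 * p)) (sym (ℕ.+-identityʳ (s + j * p))))
              (trans (residue j 0) (cong (_% (2 * p)) (ℕ.+-identityʳ (2 * s))))))

  c-inside : ∀ j i → suc i < p → c (s + j * p + suc i) ≡ + 2
  c-inside j i i<p = cong weight (q-false ((s + j * p + suc i) * 2) λ eq →
    2p∤ i i<p (%-≡⇒∣ (2 * s) (suc i * 2) (2 * p) (trans (sym (residue j (suc i))) eq)))

  θ Δ : ℕ → ℤ
  θ   = continuant c
  Δ n = θ (suc n) - θ n

  HD-θ : ∀ n → HD (2 * p) (2 * s ∷ []) n ≡ θ n
  HD-θ n = trans (hankel-cong N-moment n) (hankel-moment c n)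

  -- The first two values are 1 because `c 0` is 1, and before level `s` each later one is
  -- `2 · 1 - 1`.
  θ-initial : ∀ n → n ≤ s → θ n ≡ + 1
  θ-initial zero          _   = refl
  θ-initial (suc zero)    _   = refl
  θ-initial (suc (suc n)) n<s = trans (continuant-last c n)
    (cong₂ _-_ (cong₂ _*ℤ_ (c-initial n n<s) (θ-initial (suc n) (ℕ.<⇒≤ n<s)))
               (θ-initial n (ℕ.<⇒≤ (ℕ.<⇒≤ n<s))))

  Δ-regular : ∀ n → c (suc n) ≡ + 2 → Δ (suc n) ≡ Δ n
  Δ-regular n eq = trans (cong (_- θ (suc n)) (trans (continuant-last c n) (cong (λ z → z *ℤ θ (suc n) - θ n) eq)))
                         (rearrange (θ (suc n)) (θ n))
    where
    rearrange : ∀ x y → + 2 *ℤ x - y - x ≡ x - y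
    rearrange = solve-∀

  θ-forbidden : ∀ n → c (suc n) ≡ + 1 → θ (suc (suc n)) ≡ Δ n
  θ-forbidden n eq = trans (continuant-last c n)
    (trans (cong (λ z → z *ℤ θ (suc n) - θ n) eq) (cong (_- θ n) (ℤ.*-identityˡ (θ (suc n)))))

  -- Passing from `Δ (s + j * p)` to `Δ (s + j * p + i)` with `i < p` meets only levels strictly
  -- between two forbidden ones.
  Δ-constant : ∀ j i → i < p → Δ (s + j * p + i) ≡ Δ (s + j * p)
  Δ-constant j zero    _   = cong Δ (ℕ.+-identityʳ (s + j * p))
  Δ-constant j (suc i) i<p =
    trans (cong Δ (ℕ.+-suc (s + j * p) i))
          (trans (Δ-regular (s + j * p + i) (trans (cong c (sym (ℕ.+-suc (s + j * p) i))) (c-inside j i i<p)))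
                 (Δ-constant j i (ℕ.<⇒≤ i<p)))

  section-end : ∀ j → s + suc j * p ≡ suc (s + j * p + p′)
  section-end j = trans (cong (λ z → s + z) (ℕ.+-comm p (j * p)))
    (trans (sym (ℕ.+-assoc s (j * p) p)) (ℕ.+-suc (s + j * p) p′))

  -- The forbidden level `s + suc j * p` makes the next minor equal to the difference just before
  -- it, which is still that of the section now ending.
  θ-next : ∀ j → θ (s + suc j * p + 1) ≡ Δ (s + j * p)
  θ-next j = begin
    θ (s + suc j * p + 1)         ≡⟨ cong θ (trans (ℕ.+-comm _ 1) (cong suc (section-end j))) ⟩
    θ (2 + (s + j * p + p′))      ≡⟨ θ-forbidden (s + j * p + p′) (trans (cong c (sym (section-end j))) (c-end (suc j))) ⟩
    Δ (s + j * p + p′)            ≡⟨ Δ-constant j p′ ℕ.≤-refl ⟩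
    Δ (s + j * p)                 ∎
    where open ≡-Reasoning

  a : ℕ → ℕ → ℤ
  a j i = θ (s + (j ∸ 1) * p + i)

  -- Read off at the step into section `j`, from the term before it to `a j 1`. This also fixes
  -- `d j` when `p` is 1 and a section has no inner difference.
  d : ℕ → ℤ
  d j = Δ (s + (j ∸ 1) * p)

  a-progression : ∀ j i → i < p → a j (suc i) - a j i ≡ d j
  a-progression j i i<p =
    trans (cong (λ z → θ z - a j i) (ℕ.+-suc (s + (j ∸ 1) * p) i)) (Δ-constant (j ∸ 1) i i<p)

  -- Level `s` is the first forbidden one, and the difference before it is `1 - 1`.
  θ-after-initial : θ (suc s) ≡ + 0
  θ-after-initial = trans (θ-forbidden s′ (trans (cong c (sym (ℕ.+-identityʳ s))) (c-end 0)))
    (cong₂ _-_ (θ-initial s ℕ.≤-refl) (θ-initial s′ (ℕ.n≤1+n s′)))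

  a-first : a 1 1 ≡ + 0
  a-first = trans (cong θ (trans (ℕ.+-comm (s + 0) 1) (cong suc (ℕ.+-identityʳ s)))) θ-after-initial

  d-first : d 1 ≡ - (+ 1)
  d-first = trans (cong Δ (ℕ.+-identityʳ s)) (cong₂ _-_ θ-after-initial (θ-initial s ℕ.≤-refl))

  -- By the choice of `d` this is the first term of the new section, which `θ-next` evaluates, minus
  -- the last term of the old one, at index `s + suc j * p`.
  d-next : ∀ j → d (suc (suc j)) ≡ d (suc j) - a (suc j) p
  d-next j = cong₂ _-_
    (trans (cong θ (sym (ℕ.+-comm (s + suc j * p) 1))) (θ-next j))
    (cong θ (trans (section-end j) (sym (ℕ.+-suc (s + j * p) p′))))

theorem3p1 : (p s : ℕ) → 1 ≤ p → 1 ≤ s → s ≤ p →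
    Σ (ℕ → ℕ → ℤ) λ a → Σ (ℕ → ℤ) λ d →
    ((n : ℕ) → 1 ≤ n → n ≤ s → HD (2 * p) (2 * s ∷ []) n ≡ + 1)
    × ((j i : ℕ) → 1 ≤ j → 1 ≤ i → i ≤ p →
    HD (2 * p) (2 * s ∷ []) (s + (j ∸ 1) * p + i) ≡ a j i)
    × ((j i : ℕ) → 1 ≤ j → 1 ≤ i → i < p → a j (suc i) - a j i ≡ d j)
    × (a 1 1 ≡ + 0)
    × (d 1 ≡ - (+ 1))
    × ((j : ℕ) → 2 ≤ j → a j 1 ≡ d (j ∸ 1))
    × ((j : ℕ) → 2 ≤ j → d j ≡ d (j ∸ 1) - a (j ∸ 1) p)
theorem3p1 (suc p′) (suc s′) _ _ s≤p =
  a , d ,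
  (λ n _ n≤s → trans (HD-θ n) (θ-initial n n≤s)) ,
  (λ j i _ _ _ → HD-θ (s + (j ∸ 1) * p + i)) ,
  (λ j i _ _ i<p → a-progression j i i<p) ,
  a-first ,
  d-first ,
  (λ { (suc (suc j)) _ → θ-next j ; (suc zero) (s≤s ()) }) ,
  (λ { (suc (suc j)) _ → d-next j ; (suc zero) (s≤s ()) })
  where open Sections p′ s′ s≤p
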